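{- Let $r,s,n$ be positive integers. There exists a consistently signed intercalate matrix of type $(r,s,n)$ if and only if there exists a consistently signed intercalate matrix $M$ of type $(r,s,n)$ such that, as signed entries, \begin{itemize} \item the first row of $M$ has entries $1,2,3,\dots,s$ (in this order, all with sign $+$), and \item the $(i,i)$ entry of $M$ is $1$ (with sign $+$) for every $1\le i\leq \left\lceil \frac{rs}{n}\right\rceil$. \end{itemize}
   Context: An intercalate matrix of type $(r,s,n)$ is an $r\times s$ matrix $C$ with entries (called colors) in the set $\{1,\dots,n\}$ such that: the entries along each row are distinct; the entries along each column are distinct; and if $C_{ij}=C_{i'j'}$, then $C_{ij'}=C_{i'j}$ (equivalently, each $2\times 2$ submatrix, formed from two distinct rows and two distinct columns, contains an even number of distinct elements). Not every color is required to occur. Such a matrix is called consistently signed if each entry is assigned a sign ($+$ or $-$) such that whenever $i\ne i'$, $j\neq j'$ and $C_{ij}=C_{i'j'}$ (and hence $C_{ij'}=C_{i'j}$), the $2\times2$ submatrix consisting of the four entries at $(i,j),(i,j'),(i',j),(i',j')$ has an odd number of minus signs. A consistently signed intercalate matrix is thus written as an $r\times s$ matrix with signed entries in $\{\pm1,\dots,\pm n\}$; the color of a signed entry is its absolute value, and equality or distinctness in the intercalate conditions refers to colors. -}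

module Defs where

open import Data.Fin.Base using (Fin; toℕ)
open import Data.Integer.Base as ℤ using (ℤ; _◃_)
open import Data.Nat.Base using (ℕ; suc; parity; NonZero; _*_; _≤_)
open import Data.Parity.Base using (1ℙ)
open import Data.Product.Base using (_×_; _,_; proj₁; proj₂; ∃-syntax)
open import Data.Rational.Unnormalised.Base using (_/_; ceiling)
open import Data.Sign.Base as Sign using (Sign)
open import Data.Sign.Properties using (_≟_)
open import Data.Vec.Base using (_∷_; []; count)
open import Data.Vec.Functional using (Vector)
open import Function.Definitions using (Injective)
open import Relation.Binary.PropositionalEquality.Core using (_≡_; _≢_)

Matrix : Set → ℕ → ℕ → Set
Matrix A r s = Vector (Vector A s) r

-- The index c : Fin n stands for the color c + 1 ∈ {1,…,n}.
SignedColor : ℕ → Set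
SignedColor n = Sign × Fin n

toℤ : ∀ {n} → SignedColor n → ℤ
toℤ (σ , c) = σ ◃ suc (toℕ c)

SignedMatrix : ℕ → ℕ → ℕ → Set
SignedMatrix r s n = Matrix (SignedColor n) r s

module _ {r s n : ℕ} where

  colors : SignedMatrix r s n → Matrix (Fin n) r s
  colors M i j = proj₂ (M i j)

  signs : SignedMatrix r s n → Matrix Sign r s
  signs M i j = proj₁ (M i j)

  record IsIntercalate (C : Matrix (Fin n) r s) : Set where
    field
      row-distinct    : ∀ i → Injective _≡_ _≡_ (λ j → C i j)
      column-distinct : ∀ j → Injective _≡_ _≡_ (λ i → C i j)
      intercalate     : ∀ {i i′ j j′} → C i j ≡ C i′ j′ → C i j′ ≡ C i′ j

  minusCount : Matrix Sign r s → Fin r → Fin r → Fin s → Fin s → ℕ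
  minusCount σ i i′ j j′ =
    count (_≟ Sign.-) (σ i j ∷ σ i j′ ∷ σ i′ j ∷ σ i′ j′ ∷ [])

  record IsConsistentlySigned (M : SignedMatrix r s n) : Set where
    field
      isIntercalate : IsIntercalate (colors M)
      odd-minuses   : ∀ {i i′ j j′} → i ≢ i′ → j ≢ j′ →
                      colors M i j ≡ colors M i′ j′ →
                      parity (minusCount (signs M) i i′ j j′) ≡ 1ℙ

  -- Positions k, l are counted from 1. The statement includes that (k , l) is
  -- a position of M, so it fails for k or l out of range.
  HasEntry : SignedMatrix r s n → ℕ → ℕ → ℤ → Set
  HasEntry M k l z =
    ∃[ i ] ∃[ j ] (suc (toℕ i) ≡ k × suc (toℕ j) ≡ l × toℤ (M i j) ≡ z)

  FirstRowStandard : SignedMatrix r s n → Set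
  FirstRowStandard M = ∀ j → 1 ≤ j → j ≤ s → HasEntry M 1 j (ℤ.+ j)

  DiagonalOnes : .{{NonZero n}} → SignedMatrix r s n → Set
  DiagonalOnes M =
    ∀ i → 1 ≤ i → ℤ.+ i ℤ.≤ ceiling (ℤ.+ (r * s) / n) → HasEntry M i i (ℤ.+ 1)

{-# OPTIONS --safe #-}

-- Some color c occurs at least ⌈rs/n⌉ times; as C is intercalate, these positions
-- lie in distinct rows and distinct columns, so rows and columns can be permuted to
-- put them on the diagonal. Permuting the colors then turns the first row into
-- 1,…,s and c into 1. Each 2×2 submatrix has two entries in each of its rows and
-- columns, so negating a row or a column keeps the signing consistent: negate
-- columns to make the first row positive, then rows to make the diagonal positive.
module Submission where

open import Defs
open import Data.Fin.Base using (Fin; zero; suc; toℕ; fromℕ<; inject≤; combine; remQuot; punchIn; punchOut)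
open import Data.Fin.Permutation as Perm using (Permutation′; _⟨$⟩ʳ_; _⟨$⟩ˡ_)
import Data.Fin.Properties as Fin
open import Data.Integer.Base as ℤ using (+_; +[1+_]; -[1+_])
import Data.Integer.DivMod as ℤ
import Data.Integer.Properties as ℤ
open import Data.List.Base using (List; []; _∷_; length; filter; lookup; allFin)
open import Data.List.Membership.Propositional.Properties using (∈-lookup)
import Data.List.Properties as List
open import Data.List.Relation.Unary.All as All using (All; []; _∷_)
import Data.List.Relation.Unary.All.Properties as All
open import Data.List.Relation.Unary.AllPairs using (_∷_)
open import Data.List.Relation.Unary.Unique.Propositional using (Unique)
import Data.List.Relation.Unary.Unique.Propositional.Properties as Unique
open import Data.Nat.Base as ℕ using (ℕ; zero; suc; parity; NonZero; _+_; _*_; _⊓_; _≤_; _<_; s≤s; z≤n)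
import Data.Nat.Properties as ℕ
open import Data.Parity.Properties using () renaming (_≟_ to _≟ℙ_)
open import Data.Product.Base using (_×_; _,_; proj₁; proj₂; uncurry; Σ-syntax; ∃-syntax)
open import Data.Rational.Unnormalised.Base using (ceiling; _/_)
open import Data.Sign.Base as Sign using (Sign)
import Data.Sign.Properties as Sign
open import Data.Vec.Base using ([]; _∷_; count)
open import Function.Base using (_∘_)
open import Function.Bundles using (_⇔_; mk⇔)
open import Function.Definitions using (Injective)
open import Relation.Binary.PropositionalEquality
open import Relation.Nullary using (Dec; yes; no; ¬?; contradiction)
open import Relation.Nullary.Decidable using (map′; _×-dec_; from-yes)
open import Relation.Unary using (Decidable)

-- Finite combinatorics

length-filter-¬filter : ∀ {A : Set} {P : A → Set} (P? : Decidable P) xs →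
  length (filter P? xs) + length (filter (¬? ∘ P?) xs) ≡ length xs
length-filter-¬filter P? [] = refl
length-filter-¬filter P? (x ∷ xs) with P? x
... | yes _ = cong suc (length-filter-¬filter P? xs)
... | no _  = trans (ℕ.+-suc _ _) (cong suc (length-filter-¬filter P? xs))

lookup-injective : ∀ {A : Set} {xs : List A} → Unique xs → Injective _≡_ _≡_ (lookup xs)
lookup-injective (_ ∷ _)   {zero}  {zero}  _  = refl
lookup-injective (x∉ ∷ _)  {zero}  {suc j} eq = contradiction eq (All.lookup x∉ (∈-lookup j))
lookup-injective (x∉ ∷ _)  {suc i} {zero}  eq = contradiction (sym eq) (All.lookup x∉ (∈-lookup i))
lookup-injective (_ ∷ xs!) {suc i} {suc j} eq = cong suc (lookup-injective xs! eq)

-- Induction on `n`: either the largest allowed value is taken more than `k` times, or dropping its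
-- at most `k` occurrences leaves a long enough list. With values in `ℕ`, the bound can shrink while
-- `f` stays fixed.
pigeonhole-list : ∀ {A : Set} (f : A → ℕ) n k {xs} → Unique xs → All (λ x → f x < n) xs →
  n * k < length xs → ∃[ c ] ∃[ ys ] (Unique ys × All (λ y → f y ≡ c) ys × k < length ys)
pigeonhole-list f zero k {_ ∷ _} _ (() ∷ _) _
pigeonhole-list f (suc n) k {xs} xs! f<1+n big with k ℕ.<? length (filter (λ x → f x ℕ.≟ n) xs)
... | yes k< = n , _ , Unique.filter⁺ _ xs! , All.all-filter _ xs , k<
... | no k≮  = pigeonhole-list f n k (Unique.filter⁺ ≢n? xs!) f<n rest-big
  where
  ≡n? = λ x → f x ℕ.≟ n
  ≢n? = ¬? ∘ ≡n?
  f<n : All (λ x → f x < n) (filter ≢n? xs)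
  f<n = All.zipWith (λ (f≢n , f≤n) → ℕ.≤∧≢⇒< (ℕ.s≤s⁻¹ f≤n) f≢n)
          (All.all-filter ≢n? xs , All.filter⁺ ≢n? f<1+n)
  rest-big : n * k < length (filter ≢n? xs)
  rest-big = ℕ.+-cancelˡ-< k _ _ (begin-strict
    k + n * k                                          <⟨ big ⟩
    length xs                                          ≡⟨ length-filter-¬filter ≡n? xs ⟨
    length (filter ≡n? xs) + length (filter ≢n? xs)    ≤⟨ ℕ.+-monoˡ-≤ _ (ℕ.≮⇒≥ k≮) ⟩
    k + length (filter ≢n? xs)                         ∎)
    where open ℕ.≤-Reasoning

pigeonhole : ∀ {N n} k (f : Fin N → Fin n) → n * k < N →
  ∃[ c ] Σ[ g ∈ (Fin (suc k) → Fin N) ] (Injective _≡_ _≡_ g × ∀ t → f (g t) ≡ c)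
pigeonhole {N} {n} k f big
  with c , ys , ys! , f≡c , k< ← pigeonhole-list (toℕ ∘ f) n k (Unique.allFin⁺ N)
         (All.universal (Fin.toℕ<n ∘ f) (allFin N)) (subst (n * k <_) (sym (List.length-tabulate _)) big)
  -- The list version yields a natural number only; the value at the first chosen index supplies it
  -- as an element of `Fin n`.
  = f (g zero) , g , Fin.inject≤-injective k< k< _ _ ∘ lookup-injective ys!
  , λ t → Fin.toℕ-injective (trans (color t) (sym (color zero)))
  where
  g : Fin (suc k) → Fin N
  g t = lookup ys (inject≤ t k<)
  color : ∀ t → toℕ (f (g t)) ≡ c
  color t = All.lookup f≡c (∈-lookup (inject≤ t k<))

-- Recursion on `m`: delete `f zero` from the codomain, extend the rest of `f`, and insert
-- `zero ↦ f zero` again. Comparing indices through `toℕ` avoids an embedding of `Fin m` into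
-- `Fin n`.
extend-to-permutation : ∀ {m n} (f : Fin m → Fin n) → Injective _≡_ _≡_ f →
  Σ[ π ∈ Permutation′ n ] (∀ {i j} → toℕ i ≡ toℕ j → π ⟨$⟩ʳ i ≡ f j)
extend-to-permutation {zero} f f-inj = Perm.id , λ { {_} {()} }
extend-to-permutation {suc m} {zero} f f-inj with () ← f zero
extend-to-permutation {suc m} {suc n} f f-inj = Perm.insert zero (f zero) π , λ {i} {j} → extends i j
  where
  f₀≢ : ∀ j → f zero ≢ f (suc j)
  f₀≢ j eq with () ← f-inj eq
  rest = extend-to-permutation (λ j → punchOut (f₀≢ j))
           (Fin.suc-injective ∘ f-inj ∘ Fin.punchOut-injective (f₀≢ _) (f₀≢ _))
  π = proj₁ rest
  extends : ∀ i j → toℕ i ≡ toℕ j → Perm.insert zero (f zero) π ⟨$⟩ʳ i ≡ f j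
  extends zero    zero    _  = refl
  extends (suc i) (suc j) eq = begin
    Perm.insert zero (f zero) π ⟨$⟩ʳ suc i    ≡⟨ Perm.insert-punchIn zero (f zero) π i ⟩
    punchIn (f zero) (π ⟨$⟩ʳ i)               ≡⟨ cong (punchIn (f zero)) (proj₂ rest (ℕ.suc-injective eq)) ⟩
    punchIn (f zero) (punchOut (f₀≢ j))       ≡⟨ Fin.punchIn-punchOut (f₀≢ j) ⟩
    f (suc j)                                 ∎
    where open ≡-Reasoning

permutation-injective : ∀ {n} (π : Permutation′ n) → Injective _≡_ _≡_ (π ⟨$⟩ʳ_)
permutation-injective π eq = trans (sym (Perm.inverseˡ π)) (trans (cong (π ⟨$⟩ˡ_) eq) (Perm.inverseˡ π))

-- The ceiling is minus the floor of `- N / n`, so that floor is `- (k + 1)`, and a number is less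
-- than `n` times one more than its floor quotient: `- N < - k * n`.
ceiling-bound : ∀ N n .{{_ : NonZero n}} k → ceiling (+ N / n) ≡ +[1+ k ] → n * k < N
ceiling-bound N n@(suc _) k eq = ℤ.drop‿+<+ (ℤ.neg-cancel-< (begin-strict
  ℤ.- + N                        <⟨ ℤ.n<s[n/ℕd]*d (ℤ.- + N) n ⟩
  ℤ.suc (ℤ.- + N ℤ./ℕ n) ℤ.* + n ≡⟨ cong (λ q → ℤ.suc q ℤ.* + n) floor≡ ⟩
  ℤ.suc -[1+ k ] ℤ.* + n         ≡⟨ cong (ℤ._* + n) (ℤ.⊖-≤ {1} {suc k} (s≤s z≤n)) ⟩
  ℤ.- + k ℤ.* + n                ≡⟨ ℤ.neg-distribˡ-* (+ k) (+ n) ⟨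
  ℤ.- (+ k ℤ.* + n)              ≡⟨ cong ℤ.-_ (ℤ.pos-* k n) ⟨
  ℤ.- + (k * n)                  ≡⟨ cong (ℤ.-_ ∘ +_) (ℕ.*-comm k n) ⟩
  ℤ.- + (n * k)                  ∎))
  where
  open ℤ.≤-Reasoning
  floor≡ : ℤ.- + N ℤ./ℕ n ≡ -[1+ k ]
  floor≡ = trans (sym (ℤ.div-pos-is-/ℕ (ℤ.- + N) n))
             (trans (sym (ℤ.neg-involutive _)) (cong ℤ.-_ eq))

ceiling-pred : ∀ N n .{{_ : NonZero n}} → 0 < N → ∃[ k ] (n * k < N × ceiling (+ N / n) ℤ.≤ +[1+ k ])
ceiling-pred N n 0<N with ceiling (+ N / n) in eq
... | +[1+ k ] = k , ceiling-bound N n k eq , ℤ.≤-refl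
-- A positive fraction has a positive ceiling, but `k = 0` satisfies both bounds here, so no
-- refutation is called for.
... | + 0      = 0 , subst (_< N) (sym (ℕ.*-zeroʳ n)) 0<N , ℤ.+≤+ z≤n
... | -[1+ _ ] = 0 , subst (_< N) (sym (ℕ.*-zeroʳ n)) 0<N , ℤ.-≤+

-- Operations on consistently signed intercalate matrices

∀-Sign? : ∀ {P : Sign → Set} → (∀ x → Dec (P x)) → Dec (∀ x → P x)
∀-Sign? P? = map′ (λ { (p , q) Sign.+ → p ; (p , q) Sign.- → q })
                  (λ p → p Sign.+ , p Sign.-) (P? Sign.+ ×-dec P? Sign.-)

-- `minusCount` with the four signs as plain variables, so that statements about it can be decided
-- by enumeration.
minuses : Sign → Sign → Sign → Sign → ℕ
minuses a b c d = count (Sign._≟ Sign.-) (a ∷ b ∷ c ∷ d ∷ [])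

-- Each factor acts on two of the four signs, so it changes the count by an even number. The proof
-- evaluates all 64 cases.
parity-negate-rows : ∀ x y a b c d →
  parity (minuses (x Sign.* a) (x Sign.* b) (y Sign.* c) (y Sign.* d)) ≡ parity (minuses a b c d)
parity-negate-rows = from-yes
  (∀-Sign? λ x → ∀-Sign? λ y → ∀-Sign? λ a → ∀-Sign? λ b → ∀-Sign? λ c → ∀-Sign? λ d →
   parity (minuses (x Sign.* a) (x Sign.* b) (y Sign.* c) (y Sign.* d)) ≟ℙ parity (minuses a b c d))

parity-negate-columns : ∀ x y a b c d →
  parity (minuses (x Sign.* a) (y Sign.* b) (x Sign.* c) (y Sign.* d)) ≡ parity (minuses a b c d)
parity-negate-columns = from-yes
  (∀-Sign? λ x → ∀-Sign? λ y → ∀-Sign? λ a → ∀-Sign? λ b → ∀-Sign? λ c → ∀-Sign? λ d →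
   parity (minuses (x Sign.* a) (y Sign.* b) (x Sign.* c) (y Sign.* d)) ≟ℙ parity (minuses a b c d))

module _ {r s n : ℕ} {M : SignedMatrix r s n} (M-cons : IsConsistentlySigned M) where
  open IsConsistentlySigned M-cons
  open IsIntercalate isIntercalate

  reindex : ∀ {r′ s′} {p : Fin r′ → Fin r} {q : Fin s′ → Fin s} →
    Injective _≡_ _≡_ p → Injective _≡_ _≡_ q → IsConsistentlySigned (λ i j → M (p i) (q j))
  reindex p-inj q-inj = record
    { isIntercalate = record
      { row-distinct    = λ i → q-inj ∘ row-distinct _
      ; column-distinct = λ j → p-inj ∘ column-distinct _
      ; intercalate     = intercalate
      }
    ; odd-minuses = λ i≢i′ j≢j′ → odd-minuses (i≢i′ ∘ p-inj) (j≢j′ ∘ q-inj)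
    }

  recolor : ∀ {m} {π : Fin n → Fin m} → Injective _≡_ _≡_ π →
    IsConsistentlySigned (λ i j → signs M i j , π (colors M i j))
  recolor {π = π} π-inj = record
    { isIntercalate = record
      { row-distinct    = λ i → row-distinct i ∘ π-inj
      ; column-distinct = λ j → column-distinct j ∘ π-inj
      ; intercalate     = cong π ∘ intercalate ∘ π-inj
      }
    ; odd-minuses = λ i≢i′ j≢j′ → odd-minuses i≢i′ j≢j′ ∘ π-inj
    }

  negate : (ρ : Fin r → Sign) (κ : Fin s → Sign) →
    IsConsistentlySigned (λ i j → ρ i Sign.* (κ j Sign.* signs M i j) , colors M i j)
  negate ρ κ = record
    { isIntercalate = isIntercalate
    ; odd-minuses   = λ {i} {i′} {j} {j′} i≢i′ j≢j′ eq →
        trans (parity-negate-rows (ρ i) (ρ i′) (κ j Sign.* signs M i j) (κ j′ Sign.* signs M i j′)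
                 (κ j Sign.* signs M i′ j) (κ j′ Sign.* signs M i′ j′))
          (trans (parity-negate-columns (κ j) (κ j′) (signs M i j) (signs M i j′)
                    (signs M i′ j) (signs M i′ j′))
            (odd-minuses i≢i′ j≢j′ eq))
    }

  frequent-color : ∀ k → n * k < r * s →
    Σ[ a ∈ (Fin (suc k) → Fin r) ] Σ[ b ∈ (Fin (suc k) → Fin s) ] ∃[ c ]
      (Injective _≡_ _≡_ a × Injective _≡_ _≡_ b × ∀ t → colors M (a t) (b t) ≡ c)
  frequent-color k big
    with c , g , g-inj , g≡c ← pigeonhole k (λ x → uncurry (colors M) (remQuot {r} s x)) big
    = a , b , c , a-inj , b-inj , g≡c
    where
    a = λ t → proj₁ (remQuot {r} s (g t))
    b = λ t → proj₂ (remQuot {r} s (g t))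
    same-position : ∀ {t u} → a t ≡ a u → b t ≡ b u → t ≡ u
    same-position {t} {u} at≡au bt≡bu = g-inj (begin
      g t                ≡⟨ Fin.combine-remQuot {r} s (g t) ⟨
      combine (a t) (b t) ≡⟨ cong₂ combine at≡au bt≡bu ⟩
      combine (a u) (b u) ≡⟨ Fin.combine-remQuot {r} s (g u) ⟩
      g u                ∎)
      where open ≡-Reasoning
    same-color : ∀ t u → colors M (a t) (b t) ≡ colors M (a u) (b u)
    same-color t u = trans (g≡c t) (sym (g≡c u))
    a-inj : Injective _≡_ _≡_ a
    -- Two occurrences of one color in a common row also share their column, hence are the same
    -- position.
    a-inj {t} {u} eq = same-position eq (row-distinct (a t)
      (trans (same-color t u) (cong (λ i → colors M i (b u)) (sym eq))))
    b-inj : Injective _≡_ _≡_ b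
    b-inj {t} {u} eq = same-position (column-distinct (b t)
      (trans (same-color t u) (cong (colors M (a u)) (sym eq)))) eq

-- Normalizing the diagonal, the colors and the signs

ConstantDiagonal : ∀ {r s n} → SignedMatrix (suc r) (suc s) n → ℕ → Set
ConstantDiagonal M k =
  ∀ {i j} → toℕ i ≡ toℕ j → toℕ i ≤ k → colors M i j ≡ colors M zero zero

-- The `k + 1` occurrences of a frequent color occupy distinct rows and distinct columns. This
-- bounds `k` by `r` and `s`, so the diagonal positions exist, and lets permutations carry the
-- occurrences there.
align-diagonal : ∀ {r s n} {M : SignedMatrix (suc r) (suc s) n} → IsConsistentlySigned M →
  ∀ k → n * k < suc r * suc s →
  k ≤ r × k ≤ s ×
  Σ[ M′ ∈ SignedMatrix (suc r) (suc s) n ] (IsConsistentlySigned M′ × ConstantDiagonal M′ k)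
align-diagonal {M = M} M-cons k big
  with a , b , c , a-inj , b-inj , ab≡c ← frequent-color M-cons k big
  with p , p≡a ← extend-to-permutation a a-inj
  with q , q≡b ← extend-to-permutation b b-inj
  = ℕ.s≤s⁻¹ (Fin.injective⇒≤ a-inj) , ℕ.s≤s⁻¹ (Fin.injective⇒≤ b-inj) , _
  , reindex M-cons (permutation-injective p) (permutation-injective q)
  , λ i≡j i≤k → trans (color≡c i≡j i≤k) (sym (color≡c {zero} {zero} refl z≤n))
  where
  color≡c : ∀ {i j} → toℕ i ≡ toℕ j → toℕ i ≤ k → colors M (p ⟨$⟩ʳ i) (q ⟨$⟩ʳ j) ≡ c
  color≡c i≡j i≤k = trans
    (cong₂ (colors M) (p≡a (sym t≡i)) (q≡b (trans (sym i≡j) (sym t≡i)))) (ab≡c t)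
    where
    t = fromℕ< (s≤s i≤k)
    t≡i = Fin.toℕ-fromℕ< (s≤s i≤k)

-- The first row is an injection from columns to colors; the inverse of a permutation extending it
-- sends each color of that row back to its column.
standardize-colors : ∀ {r s n} {M : SignedMatrix (suc r) s n} → IsConsistentlySigned M →
  Σ[ π ∈ Permutation′ n ] (∀ j → toℕ (π ⟨$⟩ʳ colors M zero j) ≡ toℕ j)
standardize-colors {s = s} {n} {M} M-cons = Perm.flip π , λ j → begin
  toℕ (π ⟨$⟩ˡ colors M zero j)       ≡⟨ cong (toℕ ∘ (π ⟨$⟩ˡ_)) (π≡ (Fin.toℕ-inject≤ j s≤n)) ⟨
  toℕ (π ⟨$⟩ˡ (π ⟨$⟩ʳ inject≤ j s≤n)) ≡⟨ cong toℕ (Perm.inverseˡ π) ⟩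
  toℕ (inject≤ j s≤n)                 ≡⟨ Fin.toℕ-inject≤ j s≤n ⟩
  toℕ j                               ∎
  where
  open ≡-Reasoning
  row-inj : Injective _≡_ _≡_ (colors M zero)
  row-inj = IsIntercalate.row-distinct (IsConsistentlySigned.isIntercalate M-cons) zero
  s≤n : s ≤ n
  s≤n = Fin.injective⇒≤ row-inj
  π = proj₁ (extend-to-permutation (colors M zero) row-inj)
  π≡ = proj₂ (extend-to-permutation (colors M zero) row-inj)

module _ {r s : ℕ} (σ : Matrix Sign (suc r) (suc s)) where

  -- Rows below the last diagonal position use the last column: their sign is irrelevant.
  diagonalColumn : Fin (suc r) → Fin (suc s)
  diagonalColumn i = fromℕ< (s≤s (ℕ.m⊓n≤n (toℕ i) s))

  -- The sign of the diagonal entry after each column has been multiplied by its top sign.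
  rowSign : Fin (suc r) → Sign
  rowSign i = σ zero (diagonalColumn i) Sign.* σ i (diagonalColumn i)

  standardSigns : Matrix Sign (suc r) (suc s)
  standardSigns i j = rowSign i Sign.* (σ zero j Sign.* σ i j)

  -- In the first row both factors are squares, so the row factor does not undo the column step.
  standardSigns-firstRow : ∀ j → standardSigns zero j ≡ Sign.+
  standardSigns-firstRow j = cong₂ Sign._*_ (Sign.s*s≡+ (σ zero zero)) (Sign.s*s≡+ (σ zero j))

  standardSigns-diagonal : ∀ {i j} → toℕ i ≡ toℕ j → standardSigns i j ≡ Sign.+
  standardSigns-diagonal {i} {j} i≡j =
    trans (cong (λ l → (σ zero l Sign.* σ i l) Sign.* (σ zero j Sign.* σ i j)) column≡j)
          (Sign.s*s≡+ (σ zero j Sign.* σ i j))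
    where
    column≡j : diagonalColumn i ≡ j
    column≡j = Fin.toℕ-injective (begin
      toℕ (diagonalColumn i) ≡⟨ Fin.toℕ-fromℕ< _ ⟩
      toℕ i ⊓ s              ≡⟨ cong (_⊓ s) i≡j ⟩
      toℕ j ⊓ s              ≡⟨ ℕ.m≤n⇒m⊓n≡m (ℕ.s≤s⁻¹ (Fin.toℕ<n j)) ⟩
      toℕ j                  ∎)
      where open ≡-Reasoning

positive-entry : ∀ {n} {σ} {c : Fin n} {k} → σ ≡ Sign.+ → toℕ c ≡ k → toℤ (σ , c) ≡ + suc k
positive-entry refl refl = refl

module _ {r s n : ℕ} {M : SignedMatrix (suc r) (suc s) n} (M-cons : IsConsistentlySigned M) where

  private
    π = proj₁ (standardize-colors M-cons)
    π≡ = proj₂ (standardize-colors M-cons)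

  standardize : SignedMatrix (suc r) (suc s) n
  standardize i j = standardSigns (signs M) i j , π ⟨$⟩ʳ colors M i j

  standardize-cons : IsConsistentlySigned standardize
  standardize-cons = negate (recolor M-cons (permutation-injective π)) (rowSign (signs M)) (signs M zero)

  standardize-firstRow : FirstRowStandard standardize
  standardize-firstRow (suc t) _ t<s =
    zero , j , refl , cong suc j≡t ,
    positive-entry (standardSigns-firstRow (signs M) j) (trans (π≡ j) j≡t)
    where
    j = fromℕ< t<s
    j≡t = Fin.toℕ-fromℕ< t<s

  standardize-diagonal : ∀ {k} → k ≤ r → k ≤ s → ConstantDiagonal M k →
    ∀ i → 1 ≤ i → i ≤ suc k → HasEntry standardize i i (+ 1)
  standardize-diagonal {k} k≤r k≤s diagonal (suc t) _ (s≤s t≤k) =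
    i , j , cong suc i≡t , cong suc j≡t ,
    positive-entry (standardSigns-diagonal (signs M) i≡j)
      -- The diagonal color is that of the corner, which lies in the first row and is therefore sent
      -- to the first color.
      (trans (cong (toℕ ∘ (π ⟨$⟩ʳ_)) (diagonal i≡j (subst (_≤ k) (sym i≡t) t≤k))) (π≡ zero))
    where
    t<r = s≤s (ℕ.≤-trans t≤k k≤r)
    t<s = s≤s (ℕ.≤-trans t≤k k≤s)
    i = fromℕ< t<r
    j = fromℕ< t<s
    i≡t = Fin.toℕ-fromℕ< t<r
    j≡t = Fin.toℕ-fromℕ< t<s
    i≡j = trans i≡t (sym j≡t)

proposition5p1 : (r s n : ℕ) .{{_ : NonZero r}} .{{_ : NonZero s}} .{{_ : NonZero n}} →
    (Σ[ M ∈ SignedMatrix r s n ] IsConsistentlySigned M)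
    ⇔
    (Σ[ M ∈ SignedMatrix r s n ]
    (IsConsistentlySigned M × FirstRowStandard M × DiagonalOnes M))
proposition5p1 (suc r) (suc s) n =
  mk⇔ (λ (M , M-cons) →
        let k , big , ⌈rs/n⌉≤1+k = ceiling-pred (suc r * suc s) n (s≤s z≤n)
            k≤r , k≤s , M₁ , M₁-cons , diagonal = align-diagonal M-cons k big
        -- Recoloring and sign changes come after the permutations, since both depend on which row
        -- ends up on top.
        in standardize M₁-cons
         , standardize-cons M₁-cons
         , standardize-firstRow M₁-cons
         , λ i 1≤i i≤⌈rs/n⌉ → standardize-diagonal M₁-cons k≤r k≤s diagonal i 1≤i
             (ℤ.drop‿+≤+ (ℤ.≤-trans i≤⌈rs/n⌉ ⌈rs/n⌉≤1+k)))
      (λ (M , M-cons , _) → M , M-cons)
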